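{- There exists a chain of length $\aleph_1$ of $\approx$-classes containing (not necessarily closed) subsemigroups of $\mathfrak{F}_2$; that is, there exist subsemigroups $S_\alpha$ ($\alpha<\aleph_1$) of $\mathfrak{F}_2$ such that $S_\alpha\prec S_\beta$ for all ordinals $\alpha<\beta<\aleph_1$.
   Context: $\mathbb{N}=\{0,1,2,\ldots\}$ and $\mathbb{N}^\mathbb{N}$ is the semigroup of all maps $\mathbb{N}\to\mathbb{N}$ under composition. $\mathfrak{F}_2=\{f\in\mathbb{N}^\mathbb{N}: |f(\mathbb{N})|\leq 2\}$. For $U,V\subseteq\mathbb{N}^\mathbb{N}$, $U\preccurlyeq V$ means there is a countable $C\subseteq\mathbb{N}^\mathbb{N}$ such that $U$ is contained in the subsemigroup generated by $V\cup C$; $U\approx V$ means $U\preccurlyeq V$ and $V\preccurlyeq U$; $U\prec V$ means $U\preccurlyeq V$ and not $U\approx V$. -}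

module Defs where

open import Data.Nat using (ℕ)
open import Data.Product using (Σ; ∃; _×_; _,_)
open import Data.Sum using (_⊎_)
open import Data.Unit using (⊤)
open import Data.Empty using (⊥)
open import Relation.Nullary using (¬_)
open import Relation.Binary.PropositionalEquality using (_≡_; _≗_)
open import Function using (_∘_)

Map : Set
Map = ℕ → ℕ

MapSet : Set₁
MapSet = Map → Set

_⊆_ : MapSet → MapSet → Set
U ⊆ V = ∀ f → U f → V f

_∪_ : MapSet → MapSet → MapSet
(U ∪ V) f = U f ⊎ V f

F₂ : MapSet
F₂ f = Σ ℕ λ a → Σ ℕ λ b → ∀ n → (f n ≡ a) ⊎ (f n ≡ b)

IsSubsemigroupOfF₂ : MapSet → Set
IsSubsemigroupOfF₂ S = (S ⊆ F₂) × (∀ f g → S f → S g → S (f ∘ g))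

-- The subsemigroup of ℕ^ℕ generated by X (maps are identified up to
-- pointwise equality, i.e. function equality).
data Gen (X : MapSet) : MapSet where
  gen-inc  : ∀ {f} → X f → Gen X f
  gen-comp : ∀ {f g} → Gen X f → Gen X g → Gen X (f ∘ g)
  gen-ext  : ∀ {f g} → f ≗ g → Gen X f → Gen X g

-- C is countable: C is covered by the range of some sequence of maps
-- (this includes finite and empty C).
Countable : MapSet → Set
Countable C = Σ (ℕ → Map) λ e → ∀ f → C f → ∃ λ n → e n ≗ f

_≼_ : MapSet → MapSet → Set₁
U ≼ V = Σ MapSet λ C → Countable C × (U ⊆ Gen (V ∪ C))

_≈_ : MapSet → MapSet → Set₁
U ≈ V = (U ≼ V) × (V ≼ U)

_≺_ : MapSet → MapSet → Set₁
U ≺ V = (U ≼ V) × ¬ (U ≈ V)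

-- Countable ordinals as Brouwer trees, with the standard order
-- (every countable ordinal, i.e. every α < ℵ₁, is denoted by some tree).
data Ord : Set where
  ozero : Ord
  osuc  : Ord → Ord
  olim  : (ℕ → Ord) → Ord

mutual
  _≤ₒ_ : Ord → Ord → Set
  ozero  ≤ₒ y = ⊤
  osuc x ≤ₒ y = x <ₒ y
  olim f ≤ₒ y = ∀ n → f n ≤ₒ y

  _<ₒ_ : Ord → Ord → Set
  x <ₒ ozero  = ⊥
  x <ₒ osuc y = x ≤ₒ y
  x <ₒ olim f = ∃ λ n → x <ₒ f n

{-# OPTIONS --safe #-}

-- Unfold a tree α into the well-founded tree of its descending paths. A letter
-- is such a path whose nodes are marked by bits, and a sequence x of letters
-- codes the set of those pairs (x₀ … xₖ₋₁ , q) for which xₖ marks the node q by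
-- true. Let S α consist of the characteristic functions of these sets.
--
-- If α ≤ β, then the tree of α embeds in that of β, and composing with the
-- induced map on pairs gives S α ≼ S β. Conversely, an element of the semigroup
-- generated by S α and a countable set C is a product c of maps in C, or it is
-- u ∘ f ∘ c with f in S α and such a (possibly empty) c. Points with different
-- histories never carry all bit patterns, so a map c pulling back enough
-- elements of S α must send the tree of β injectively to nodes of the tree of α,
-- and chains to chains; for α < β ranks forbid this, and a finite part of a
-- single path shows it. Hence one letter suffices to defeat one map c, and an
-- infinite sequence of letters defeats them all.
module Submission where

open import Defs
open import Data.Bool using (Bool; true; false; not; _∧_; if_then_else_)
open import Data.Bool.Properties using (not-¬)
import Data.Bool.Properties as Bool
open import Data.Empty using (⊥)
open import Data.Fin using (Fin; zero; suc; toℕ)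
open import Data.Fin.Properties using (pigeonhole)
open import Data.List using (List; []; _∷_; _++_; length; map; take)
open import Data.List.Properties using (≡-dec; length-map; map-injective; ∷-injective)
open import Data.Maybe using (Maybe; just; nothing)
open import Data.Maybe.Properties using (just-injective)
open import Data.Nat using (ℕ; zero; suc; _+_; _<_; _≡ᵇ_)
open import Data.Nat.Properties using (_≟_; <-cmp; n<1+n; m≤n⇒m<n∨m≡n; +-identityʳ; +-suc; <⇒≢; ≤-pred)
open import Data.Product using (Σ; ∃; ∃₂; _×_; _,_; proj₁; proj₂)
import Data.Product.Properties as Prod
open import Data.Sum using (_⊎_; inj₁; inj₂)
open import Data.Unit using (tt)
open import Function using (_∘_; id; Injective)
open import Induction.WellFounded using (Acc; acc; WellFounded)
open import Relation.Binary using (DecidableEquality; tri<; tri≈; tri>)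
open import Relation.Binary.PropositionalEquality using (_≡_; _≢_; _≗_; refl; sym; trans; cong; subst)
open import Relation.Nullary using (¬_; Dec; yes; no; does; contradiction)
open import Relation.Nullary.Decidable using (dec-true; dec-false)

-- Countable types

record Enumeration (A : Set) : Set where
  field
    decode        : ℕ → A
    encode        : A → ℕ
    decode-encode : ∀ a → decode (encode a) ≡ a

open Enumeration

next : ℕ × ℕ → ℕ × ℕ
next (a , zero)  = 0 , suc a
next (a , suc b) = suc a , b

unpair : ℕ → ℕ × ℕ
unpair zero    = 0 , 0
unpair (suc n) = next (unpair n)

-- The triangular numbers: `unpair` enters the antidiagonal `a + b ≡ t` at index `diagonal t`.
diagonal : ℕ → ℕ
diagonal zero    = 0
diagonal (suc t) = suc (t + diagonal t)

unpair-along : ∀ t → unpair (diagonal t) ≡ (0 , t) →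
               ∀ a b → a + b ≡ t → unpair (a + diagonal t) ≡ (a , b)
unpair-along t start zero    b refl = start
unpair-along t start (suc a) b eq
  rewrite unpair-along t start a (suc b) (trans (+-suc a b) eq) = refl

unpair-diagonal : ∀ t → unpair (diagonal t) ≡ (0 , t)
unpair-diagonal zero = refl
unpair-diagonal (suc t)
  rewrite unpair-along t (unpair-diagonal t) t 0 (+-identityʳ t) = refl

pair : ℕ → ℕ → ℕ
pair a b = a + diagonal (a + b)

unpair-pair : ∀ a b → unpair (pair a b) ≡ (a , b)
unpair-pair a b = unpair-along (a + b) (unpair-diagonal (a + b)) a b refl

ℕ-enum : Enumeration ℕ
ℕ-enum = record { decode = id ; encode = id ; decode-encode = λ _ → refl }

Bool-enum : Enumeration Bool
Bool-enum .decode n = n ≡ᵇ 1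
Bool-enum .encode b = if b then 1 else 0
Bool-enum .decode-encode true  = refl
Bool-enum .decode-encode false = refl

×-enum : ∀ {A B} → Enumeration A → Enumeration B → Enumeration (A × B)
×-enum E F .decode n = decode E (proj₁ (unpair n)) , decode F (proj₂ (unpair n))
×-enum E F .encode (a , b) = pair (encode E a) (encode F b)
×-enum E F .decode-encode (a , b)
  rewrite unpair-pair (encode E a) (encode F b)
        | decode-encode E a | decode-encode F b = refl

module _ {A : Set} (E : Enumeration A) where

  decodeList : ℕ → ℕ → List A
  decodeList zero    m = []
  decodeList (suc k) m = decode E (proj₁ (unpair m)) ∷ decodeList k (proj₂ (unpair m))

  encodeList : List A → ℕ
  encodeList []       = 0
  encodeList (a ∷ as) = pair (encode E a) (encodeList as)

  decodeList-encodeList : ∀ as → decodeList (length as) (encodeList as) ≡ as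
  decodeList-encodeList [] = refl
  decodeList-encodeList (a ∷ as)
    rewrite unpair-pair (encode E a) (encodeList as)
          | decode-encode E a | decodeList-encodeList as = refl

  List-enum : Enumeration (List A)
  List-enum .decode n = decodeList (proj₁ (unpair n)) (proj₂ (unpair n))
  List-enum .encode as = pair (length as) (encodeList as)
  List-enum .decode-encode as
    rewrite unpair-pair (length as) (encodeList as) = decodeList-encodeList as

-- Brouwer trees

≤ₒ-lim : ∀ x f n → x ≤ₒ f n → x ≤ₒ olim f
≤ₒ-lim ozero    f n _ = tt
≤ₒ-lim (osuc x) f n p = n , p
≤ₒ-lim (olim g) f n p = λ m → ≤ₒ-lim (g m) f n (p m)

≤ₒ-refl : ∀ x → x ≤ₒ x
≤ₒ-refl ozero    = tt
≤ₒ-refl (osuc x) = ≤ₒ-refl x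
≤ₒ-refl (olim f) = λ n → ≤ₒ-lim (f n) f n (≤ₒ-refl (f n))

<ₒ⇒≤ₒ : ∀ x y → x <ₒ y → x ≤ₒ y
≤ₒ-suc : ∀ x y → x ≤ₒ y → x ≤ₒ osuc y

<ₒ⇒≤ₒ x (osuc y) p       = ≤ₒ-suc x y p
<ₒ⇒≤ₒ x (olim f) (n , p) = ≤ₒ-lim x f n (<ₒ⇒≤ₒ x (f n) p)

≤ₒ-suc ozero    y p = tt
≤ₒ-suc (osuc x) y p = <ₒ⇒≤ₒ x y p
≤ₒ-suc (olim f) y p = λ n → ≤ₒ-suc (f n) y (p n)

≤ₒ-trans   : ∀ x y z → x ≤ₒ y → y ≤ₒ z → x ≤ₒ z
<ₒ-≤ₒ-trans : ∀ x y z → x <ₒ y → y ≤ₒ z → x <ₒ z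
≤ₒ-<ₒ-trans : ∀ x y z → x ≤ₒ y → y <ₒ z → x <ₒ z

≤ₒ-trans ozero    y z p q = tt
≤ₒ-trans (osuc x) y z p q = <ₒ-≤ₒ-trans x y z p q
≤ₒ-trans (olim f) y z p q = λ n → ≤ₒ-trans (f n) y z (p n) q

<ₒ-≤ₒ-trans x (osuc y) z p       q = ≤ₒ-<ₒ-trans x y z p q
<ₒ-≤ₒ-trans x (olim f) z (n , p) q = <ₒ-≤ₒ-trans x (f n) z p (q n)

≤ₒ-<ₒ-trans x y (osuc z) p q       = ≤ₒ-trans x y z p q
≤ₒ-<ₒ-trans x y (olim f) p (n , q) = n , ≤ₒ-<ₒ-trans x y (f n) p q

-- A limit has the children of all its terms. The list picks a term at each nested limit until a
-- successor is met; surplus entries are ignored.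
child : Ord → List ℕ → Maybe Ord
child ozero    _       = nothing
child (osuc α) _       = just α
child (olim f) []      = nothing
child (olim f) (n ∷ i) = child (f n) i

child-< : ∀ α i {β} → child α i ≡ just β → β <ₒ α
child-< (osuc α) i       refl = ≤ₒ-refl α
child-< (olim f) (n ∷ i) eq   = n , child-< (f n) i eq

-- Unfolding `<ₒ` picks a term at each limit and stops at a successor; these picks form the index.
child-cofinal : ∀ γ α → γ <ₒ α → ∃₂ λ i β → child α i ≡ just β × γ ≤ₒ β
child-cofinal γ (osuc α) p = [] , α , refl , p
child-cofinal γ (olim f) (n , p) with child-cofinal γ (f n) p
... | i , β , eq , γ≤β = n ∷ i , β , eq , γ≤β

IsChild : Ord → Ord → Set
IsChild β α = ∃ λ i → child α i ≡ just β

isChild-wellFounded : WellFounded IsChild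
isChild-wellFounded α = acc λ { (i , eq) → below α i eq }
  where
  below : ∀ α i {β} → child α i ≡ just β → Acc IsChild β
  below (osuc α) i       refl = isChild-wellFounded α
  below (olim f) (n ∷ i) eq   = below (f n) i eq

-- The second component is a mere label: it gives every child infinitely many
-- copies, and lets an embedding of trees remember the direction it came from.
Direction : Set
Direction = List ℕ × ℕ

Path : Set
Path = List Direction

data Node (α : Ord) : Path → Ord → Set where
  here : Node α [] α
  down : ∀ {i l β q ρ} → child α i ≡ just β → Node β q ρ → Node α ((i , l) ∷ q) ρ

node? : ∀ α q → Dec (∃ (Node α q))
node? α [] = yes (α , here)
node? α ((i , l) ∷ q) with child α i in eq
... | nothing = no λ { (_ , down eq′ _) → contradiction (trans (sym eq) eq′) λ () }
... | just β with node? β q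
...   | yes (ρ , n) = yes (ρ , down eq n)
...   | no ¬n = no λ { (ρ , down eq′ n) →
                  ¬n (ρ , subst (λ β → Node β q ρ) (just-injective (trans (sym eq′) eq)) n) }

node-≤ : ∀ {α q ρ} → Node α q ρ → ρ ≤ₒ α
node-≤ {α} here = ≤ₒ-refl α
node-≤ {α} {_} {ρ} (down {i} {β = β} eq n) =
  ≤ₒ-trans ρ β α (node-≤ n) (<ₒ⇒≤ₒ β α (child-< α i eq))

node-< : ∀ {α d q ρ} → Node α (d ∷ q) ρ → ρ <ₒ α
node-< {α} {ρ = ρ} (down {i} {β = β} eq n) = ≤ₒ-<ₒ-trans ρ β α (node-≤ n) (child-< α i eq)

-- Since `child` is a function, both nodes run through the same trees along `q`, and what remains is
-- `node-<`.
node-++-< : ∀ {α d r ρ σ} q → Node α q ρ → Node α (q ++ d ∷ r) σ → σ <ₒ ρ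
node-++-< []            here        m = node-< m
node-++-< ((i , l) ∷ q) (down eq n) (down eq′ m)
  with refl ← just-injective (trans (sym eq) eq′) = node-++-< q n m

-- Letters, points and the sets coded by sequences of letters

Letter : Set
Letter = List (Direction × Bool)

Legal : Ord → Letter → Set
Legal α g = ∃ (Node α (map proj₁ g))

Point : Set
Point = List Letter × Path

_≟ᵈ_ : DecidableEquality Direction
_≟ᵈ_ = Prod.≡-dec (≡-dec _≟_) _≟_

_≟ʰ_ : DecidableEquality (List Letter)
_≟ʰ_ = ≡-dec (≡-dec (Prod.≡-dec _≟ᵈ_ Bool._≟_))

-- The path of g carries the bits of g, preceded by b at the root; all other
-- nodes carry false.
bit : Bool → Letter → Path → Bool
bit b g               []       = b
bit b []              (d ∷ q)  = false
bit b ((d′ , b′) ∷ g) (d ∷ q)  = if does (d′ ≟ᵈ d) then bit b′ g q else false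

-- Histories list the most recent letter first.
history : (ℕ → Letter) → ℕ → List Letter
history x zero    = []
history x (suc k) = x k ∷ history x k

member : (ℕ → Letter) → Point → Bool
member x (s , q) = does (s ≟ʰ history x (length s)) ∧ bit false (x (length s)) q

bit-self : ∀ b d b′ g q → bit b ((d , b′) ∷ g) (d ∷ q) ≡ bit b′ g q
bit-self b d b′ g q rewrite dec-true (d ≟ᵈ d) refl = refl

bit-other : ∀ b {d d′} b′ g q → d ≢ d′ → bit b ((d , b′) ∷ g) (d′ ∷ q) ≡ false
bit-other b {d} {d′} b′ g q d≢d′ rewrite dec-false (d ≟ᵈ d′) d≢d′ = refl

bit-node : ∀ {α} b g q → Legal α g → bit b g q ≡ true → ∃ (Node α q)
bit-node {α} b g [] _ _ = α , here
bit-node b ((d , b′) ∷ g) (d′ ∷ q) (ρ , down eq n) t with d ≟ᵈ d′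
... | yes refl with bit-node b′ g q (ρ , n) t
...   | σ , m = σ , down eq m

length-history : ∀ x k → length (history x k) ≡ k
length-history x zero    = refl
length-history x (suc k) = cong suc (length-history x k)

member-history : ∀ x k q → member x (history x k , q) ≡ bit false (x k) q
member-history x k q
  rewrite length-history x k | dec-true (history x k ≟ʰ history x k) refl = refl

member⇒history : ∀ x s q → member x (s , q) ≡ true → s ≡ history x (length s)
member⇒history x s q t with s ≟ʰ history x (length s)
... | yes eq = eq

member⇒bit : ∀ x s q → member x (s , q) ≡ true → bit false (x (length s)) q ≡ true
member⇒bit x s q t with does (s ≟ʰ history x (length s))
... | true = t

-- A map that sends a child to a root is thus defeated at once; any other node has rank strictly
-- below the whole tree, which starts the descent in `defeat-injective`.
member-[] : ∀ x s → member x (s , []) ≡ false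
member-[] x s = Bool.∧-zeroʳ _

-- A history of length `k` fixes the letters of index below `k`, hence the membership of all points
-- with shorter histories. In `g ∷ t` the letter `g` has index `length t`.
predict : List Letter → Point → Bool
predict []      _       = false
predict (g ∷ t) (s , q) =
  if does (length s ≟ length t) then does (s ≟ʰ t) ∧ bit false g q else predict t (s , q)

member-predict : ∀ x k s q → length s < k → member x (s , q) ≡ predict (history x k) (s , q)
member-predict x (suc k) s q s<1+k with m≤n⇒m<n∨m≡n (≤-pred s<1+k)
... | inj₁ s<k
  rewrite length-history x k | dec-false (length s ≟ k) (<⇒≢ s<k) = member-predict x k s q s<k
... | inj₂ refl
  rewrite length-history x (length s) | dec-true (length s ≟ length s) refl = refl

-- Proper prefixes are indexed by `Fin (length q)` so that the pigeonhole principle can count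
-- ancestors.
data PathComparison (q : Path) : Path → Set where
  equal        : PathComparison q q
  longer       : ∀ d r → PathComparison q (q ++ d ∷ r)
  shorter      : (k : Fin (length q)) → PathComparison q (take (toℕ k) q)
  incomparable : ∀ {q′} → (∀ b g → bit b g q ≡ true → bit b g q′ ≡ true → ⊥) → PathComparison q q′

comparePath : ∀ q q′ → PathComparison q q′
comparePath []      []       = equal
comparePath []      (d ∷ q′) = longer d q′
comparePath (d ∷ q) []       = shorter zero
comparePath (d ∷ q) (d′ ∷ q′) with d ≟ᵈ d′
... | no d≢d′ = incomparable disjoint
  where
  disjoint : ∀ b g → bit b g (d ∷ q) ≡ true → bit b g (d′ ∷ q′) ≡ true → ⊥
  -- The single path of a letter leaves the root in only one direction.
  disjoint b ((e , _) ∷ g) t t′ with e ≟ᵈ d | e ≟ᵈ d′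
  ... | yes refl | yes refl = d≢d′ refl
... | yes refl with comparePath q q′
...   | equal          = equal
...   | longer e r     = longer e r
...   | shorter k      = shorter (suc k)
...   | incomparable h = incomparable disjoint
  where
  disjoint : ∀ b g → bit b g (d ∷ q) ≡ true → bit b g (d ∷ q′) ≡ true → ⊥
  disjoint b ((e , b′) ∷ g) t t′ with e ≟ᵈ d
  ... | yes refl = h b′ g t t′

data PointComparison : Point → Point → Set where
  excluded : ∀ {u v} a b → (∀ x → member x u ≡ a → member x v ≡ b → ⊥) → PointComparison u v
  below    : ∀ {s q} d r → PointComparison (s , q) (s , q ++ d ∷ r)
  above    : ∀ {s q} (k : Fin (length q)) → PointComparison (s , q) (s , take (toℕ k) q)

-- A member with the longer history knows whether the other point is a member.
predicted : ∀ x s q s′ q′ → length s < length s′ →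
            member x (s , q) ≡ not (predict s′ (s , q)) → member x (s′ , q′) ≡ true → ⊥
predicted x s q s′ q′ s<s′ t t′ =
  not-¬ {predict s′ (s , q)} refl
    (trans (sym (trans (member-predict x (length s′) s q s<s′)
                       (cong (λ h → predict h (s , q)) (sym (member⇒history x s′ q′ t′)))))
           t)

comparePoint : ∀ u v → PointComparison u v
comparePoint (s , q) (s′ , q′) with <-cmp (length s) (length s′)
... | tri< s<s′ _ _ = excluded _ true λ x → predicted x s q s′ q′ s<s′
... | tri> _ _ s′<s = excluded true _ λ x t t′ → predicted x s′ q′ s q s′<s t′ t
... | tri≈ _ ls≡ls′ _ with s ≟ʰ s′
...   | no s≢s′ = excluded true true λ x t t′ →
        s≢s′ (trans (member⇒history x s q t)
             (trans (cong (history x) ls≡ls′) (sym (member⇒history x s′ q′ t′))))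
...   | yes refl with comparePath q q′
-- Coincident points count as excluded: they never carry different bits.
...     | equal          = excluded false true λ x t t′ → contradiction (trans (sym t) t′) λ ()
...     | longer d r     = below d r
...     | shorter k      = above k
...     | incomparable h = excluded true true λ x t t′ →
          h false (x (length s)) (member⇒bit x s q t) (member⇒bit x s q′ t′)

LegalSeq : Ord → (ℕ → Letter) → Set
LegalSeq α x = ∀ k → Legal α (x k)

member-node : ∀ {α x} s q → LegalSeq α x → member x (s , q) ≡ true → ∃ (Node α q)
member-node {x = x} s q legal t = bit-node false (x (length s)) q (legal (length s)) (member⇒bit x s q t)

-- Defeating a single map

search : ∀ {D : Set} n {Q : Fin n → Set} → (∀ l → D ⊎ Q l) → D ⊎ (∀ l → Q l)
search zero    f = inj₂ λ ()
search (suc n) f with f zero | search n (f ∘ suc)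
... | inj₁ d | _      = inj₁ d
... | inj₂ _ | inj₁ d = inj₁ d
... | inj₂ q | inj₂ h = inj₂ λ { zero → q ; (suc l) → h l }

-- Here `v` is the effect of a left factor on truth values, and the maps `c` are right factors read
-- over one fixed history.
module Defeat (γ : Ord) (v : Bool → Bool) where

  Defeats : Bool → Letter → (Path → Point) → Set
  Defeats b g c = ∀ x → LegalSeq γ x → ¬ (∀ r → v (member x (c r)) ≡ bit b g r)

  DefeatedFrom : Bool → Ord → (Path → Point) → Set
  DefeatedFrom b δ c = Σ Letter λ g → Legal δ g × Defeats b g c

  -- Inside a tree the root bit is free, being the mark of the direction leading there; at the root
  -- of the whole tree it must be `false`.
  Defeated : Ord → (Path → Point) → Set
  Defeated δ c = ∃ λ b → DefeatedFrom b δ c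

  module _ (v-injective : Injective _≡_ _≡_ v) where

    NonMember : Point → Set
    NonMember u = ∀ x → LegalSeq γ x → member x u ≢ true

    defeat-nonMember : ∀ c {δ i δ′} l → child δ i ≡ just δ′ →
                       NonMember (c ((i , l) ∷ [])) → DefeatedFrom false δ c
    defeat-nonMember c {i = i} l eq never =
      -- As `v` is injective, the bit `v true` forces the image to be a member.
      ((i , l) , v true) ∷ [] , (_ , down eq here) , λ x legal match →
        never x legal (v-injective (trans (match _) (bit-self false (i , l) (v true) [] [])))

    defeat-pair : ∀ c {δ i δ′} l → child δ i ≡ just δ′ → ∀ a b →
                  (∀ x → member x (c []) ≡ a → member x (c ((i , l) ∷ [])) ≡ b → ⊥) →
                  Defeated δ c
    defeat-pair c {i = i} l eq a b h =
      v a , ((i , l) , v b) ∷ [] , (_ , down eq here) , λ x legal match →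
        h x (v-injective (match []))
            (v-injective (trans (match _) (bit-self (v a) (i , l) (v b) [] [])))

    -- A letter marks one sibling and leaves the other `false`, while equal images give equal bits.
    defeat-siblings : ∀ c {δ i δ′ l l′} → child δ i ≡ just δ′ → l ≢ l′ →
                      c ((i , l) ∷ []) ≡ c ((i , l′) ∷ []) → Defeated δ c
    defeat-siblings c {i = i} {l = l} {l′} eq l≢l′ same =
      false , ((i , l) , true) ∷ [] , (_ , down eq here) , λ x legal match →
        contradiction
          (trans (sym (trans (match _) (bit-self false (i , l) true [] [])))
          (trans (cong (v ∘ member x) same)
          (trans (match _) (bit-other false {i , l} {i , l′} true [] [] (l≢l′ ∘ cong proj₂)))))
          λ ()

    defeat-down : ∀ c {δ i δ′} l → child δ i ≡ just δ′ → Defeated δ′ (c ∘ ((i , l) ∷_)) →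
                  DefeatedFrom false δ c
    defeat-down c {i = i} l eq (b′ , g , (_ , n) , h) =
      ((i , l) , b′) ∷ g , (_ , down eq n) , λ x legal match →
        h x legal λ r → trans (match _) (bit-self false (i , l) b′ g r)

    -- The rank ρ of the image of the current node stays below the rank δ of that
    -- node. Among more siblings than the image has ancestors, two collide or one
    -- is not sent to an ancestor.
    defeat-below : ∀ {δ} → Acc IsChild δ → (c : Path → Point) → ∀ {s q ρ} → c [] ≡ (s , q) →
                   Node γ q ρ → ρ <ₒ δ → Defeated δ c
    defeat-below {δ} (acc rec) c {s} {q} {ρ} c[] n ρ<δ with child-cofinal ρ δ ρ<δ
    ... | i , δ′ , eq , ρ≤δ′ = conclude (search (suc (length q)) λ l → examine l refl (comparePoint _ _))
      where
      Ancestor : Fin (suc (length q)) → Set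
      Ancestor l = Σ (Fin (length q)) λ k → c ((i , toℕ l) ∷ []) ≡ (s , take (toℕ k) q)

      examine : ∀ l {w} → c ((i , toℕ l) ∷ []) ≡ w → PointComparison (s , q) w →
                Defeated δ c ⊎ Ancestor l
      examine l image (excluded a b h) =
        inj₁ (defeat-pair c (toℕ l) eq a b λ x t t′ →
          h x (trans (cong (member x) (sym c[])) t) (trans (cong (member x) (sym image)) t′))
      examine l image (above k) = inj₂ (k , image)
      examine l image (below d r) with node? γ (q ++ d ∷ r)
      -- Legal sequences have no members off the tree of `γ`.
      ... | no illegal = inj₁ (false , defeat-nonMember c (toℕ l) eq
              (λ x legal t → illegal (member-node s _ legal (trans (cong (member x) (sym image)) t))))
      -- The invariant persists: the image of the child has rank `ρ′`, which is below `ρ` and hence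
      -- below `δ′`.
      ... | yes (ρ′ , m) = inj₁ (false , defeat-down c (toℕ l) eq
              (defeat-below (rec (i , eq)) (c ∘ ((i , toℕ l) ∷_)) image m
                (<ₒ-≤ₒ-trans ρ′ ρ δ′ (node-++-< q n m) ρ≤δ′)))

      conclude : Defeated δ c ⊎ (∀ l → Ancestor l) → Defeated δ c
      conclude (inj₁ d) = d
      conclude (inj₂ h) with pigeonhole (n<1+n _) (proj₁ ∘ h)
      ... | l , l′ , l<l′ , same = defeat-siblings c eq (<⇒≢ l<l′)
              (trans (proj₂ (h l)) (trans (cong (λ k → s , take (toℕ k) q) same) (sym (proj₂ (h l′)))))

    -- The root bit is fixed to `false`, so the descent starts at a child, whose bit is free. Its
    -- image is never a member, or is a proper node of rank below `γ` and hence below `δ′`.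
    defeat-injective : ∀ {δ} → γ <ₒ δ → ∀ c → DefeatedFrom false δ c
    defeat-injective {δ} γ<δ c with child-cofinal γ δ γ<δ
    ... | i , δ′ , eq , γ≤δ′ = examine refl
      where
      examine : ∀ {s q} → c ((i , 0) ∷ []) ≡ (s , q) → DefeatedFrom false δ c
      examine {s} {[]} image = defeat-nonMember c 0 eq
        (λ x _ t → contradiction
          (trans (sym (trans (cong (member x) (sym image)) t)) (member-[] x s)) λ ())
      examine {s} {d ∷ q} image with node? γ (d ∷ q)
      ... | no illegal = defeat-nonMember c 0 eq
              (λ x legal t → illegal (member-node s _ legal (trans (cong (member x) (sym image)) t)))
      ... | yes (ρ , n) = defeat-down c 0 eq
              (defeat-below (isChild-wellFounded δ′) (c ∘ ((i , 0) ∷_)) image n (<ₒ-≤ₒ-trans ρ γ δ′ (node-< n) γ≤δ′))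

  defeat : ∀ {δ} → γ <ₒ δ → ∀ c → DefeatedFrom false δ c
  defeat {δ} γ<δ c with v false Bool.≟ v true
  ... | no distinct = defeat-injective injective γ<δ c
    where
    injective : Injective _≡_ _≡_ v
    injective {false} {false} _  = refl
    injective {true}  {true}  _  = refl
    injective {false} {true}  eq = contradiction eq distinct
    injective {true}  {false} eq = contradiction (sym eq) distinct
  -- Here `v` is constant, so demanding the other bit at one node suffices.
  ... | yes same with child-cofinal γ δ γ<δ
  ...   | i , _ , eq , _ =
    ((i , 0) , not (v false)) ∷ [] , (_ , down eq here) , λ x _ match →
      not-¬ {v false} refl
        (trans (sym (constant _)) (trans (match ((i , 0) ∷ [])) (bit-self false (i , 0) _ [] [])))
    where
    constant : ∀ b → v b ≡ v false
    constant false = refl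
    constant true  = sym same

-- Diagonalisation

Avoidable : Ord → ((Point → Bool) → Set) → Set
Avoidable δ K = ∀ s → Σ Letter λ g →
  Legal δ g × (∀ B → K B → ¬ (∀ q → B (s , q) ≡ bit false g q))

module _ {δ : Ord} (K : ℕ → (Point → Bool) → Set) (avoid : ∀ n → Avoidable δ (K n)) where

  genericHistory : ℕ → List Letter
  genericHistory zero    = []
  genericHistory (suc n) = proj₁ (avoid n (genericHistory n)) ∷ genericHistory n

  generic : ℕ → Letter
  generic n = proj₁ (avoid n (genericHistory n))

  history-generic : ∀ n → history generic n ≡ genericHistory n
  history-generic zero    = refl
  history-generic (suc n) = cong (generic n ∷_) (history-generic n)

  generic-legal : LegalSeq δ generic
  generic-legal n = proj₁ (proj₂ (avoid n (genericHistory n)))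

  -- The bits over the generic history of length `n` depend on letter `n` alone, so no later choice
  -- undoes stage `n`.
  generic-avoids : ∀ n → ¬ K n (member generic)
  generic-avoids n k = proj₂ (proj₂ (avoid n (genericHistory n))) _ k λ q →
    trans (cong (λ s → member generic (s , q)) (sym (history-generic n))) (member-history generic n q)

-- The semigroups

Direction-enum : Enumeration Direction
Direction-enum = ×-enum (List-enum ℕ-enum) ℕ-enum

Point-enum : Enumeration Point
Point-enum = ×-enum (List-enum (List-enum (×-enum Direction-enum Bool-enum))) (List-enum Direction-enum)

-- The values 0 and 1 of characteristic functions are sent to a point that is
-- never a member, so that every product of two characteristic functions is 0.
pointAt : ℕ → Point
pointAt zero          = [] , []
pointAt (suc zero)    = [] , []
pointAt (suc (suc m)) = decode Point-enum m

codeOf : Point → ℕ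
codeOf p = suc (suc (encode Point-enum p))

pointAt-codeOf : ∀ p → pointAt (codeOf p) ≡ p
pointAt-codeOf = decode-encode Point-enum

χ : (ℕ → Letter) → Map
χ x n = if member x (pointAt n) then 1 else 0

S : Ord → MapSet
S α f = Σ (ℕ → Letter) λ x → LegalSeq α x × f ≗ χ x

χ-two-valued : ∀ x n → χ x n ≡ 0 ⊎ χ x n ≡ 1
χ-two-valued x n with member x (pointAt n)
... | true  = inj₂ refl
... | false = inj₁ refl

χ∘χ : ∀ x y n → χ x (χ y n) ≡ 0
χ∘χ x y n with χ-two-valued y n
... | inj₁ eq rewrite eq = refl
... | inj₂ eq rewrite eq = refl

bit-[] : ∀ q → bit false [] q ≡ false
bit-[] []      = refl
bit-[] (_ ∷ _) = refl

χ-empty : ∀ n → χ (λ _ → []) n ≡ 0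
χ-empty n with pointAt n
... | s , q rewrite bit-[] q | Bool.∧-zeroʳ (does (s ≟ʰ history (λ _ → []) (length s))) = refl

S-subsemigroup : ∀ α → IsSubsemigroupOfF₂ (S α)
S-subsemigroup α = two-valued , closed
  where
  two-valued : S α ⊆ F₂
  two-valued f (x , _ , f≗χ) = 0 , 1 , λ n → subst (λ m → m ≡ 0 ⊎ m ≡ 1) (sym (f≗χ n)) (χ-two-valued x n)

  closed : ∀ f g → S α f → S α g → S α (f ∘ g)
  -- All products are constantly 0, and this map lies in `S α`: the empty letter is legal in every
  -- tree and codes the empty set.
  closed f g (x , _ , f≗χ) (y , _ , g≗χ) = (λ _ → []) , (λ _ → α , here) , λ n →
    trans (f≗χ (g n)) (trans (cong (χ x) (g≗χ n)) (trans (χ∘χ x y n) (sym (χ-empty n))))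

-- Monotonicity

Embedding : Set
Embedding = ∃₂ _≤ₒ_

source target : Embedding → Ord
source (α , _ , _) = α
target (_ , β , _) = β

stepTo : ∀ E i (m : Maybe Ord) → child (source E) i ≡ m → List ℕ × Embedding
-- A default for directions off the source tree; the label keeps `step` injective there.
stepTo E             i nothing  _  = [] , E
stepTo (α , β , α≤β) i (just γ) eq with child-cofinal γ β (<ₒ-≤ₒ-trans γ α β (child-< α i eq) α≤β)
... | j , β′ , _ , γ≤β′ = j , γ , β′ , γ≤β′

step : Embedding → Direction → Direction × Embedding
step E (i , l) with stepTo E i (child (source E) i) refl
... | j , F = (j , encode Direction-enum (i , l)) , F

stepTo-child : ∀ E i m (eq : child (source E) i ≡ m) {γ} → m ≡ just γ →
               child (target E) (proj₁ (stepTo E i m eq)) ≡ just (target (proj₂ (stepTo E i m eq)))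
               × source (proj₂ (stepTo E i m eq)) ≡ γ
stepTo-child (α , β , α≤β) i (just γ) eq refl
  with child-cofinal γ β (<ₒ-≤ₒ-trans γ α β (child-< α i eq) α≤β)
... | _ , _ , eq′ , _ = eq′ , refl

step-child : ∀ E i l {γ} → child (source E) i ≡ just γ →
             child (target E) (proj₁ (proj₁ (step E (i , l)))) ≡ just (target (proj₂ (step E (i , l))))
             × source (proj₂ (step E (i , l))) ≡ γ
step-child E i l ch = stepTo-child E i (child (source E) i) refl ch

step-injective : ∀ E d d′ → proj₁ (step E d) ≡ proj₁ (step E d′) → d ≡ d′
step-injective E d d′ eq =
  trans (sym (decode-encode Direction-enum d))
  (trans (cong (decode Direction-enum ∘ proj₂) eq) (decode-encode Direction-enum d′))

embedPath : Embedding → Path → Path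
embedPath E []      = []
embedPath E (d ∷ q) = proj₁ (step E d) ∷ embedPath (proj₂ (step E d)) q

embedLetter : Embedding → Letter → Letter
embedLetter E []            = []
embedLetter E ((d , b) ∷ g) = (proj₁ (step E d) , b) ∷ embedLetter (proj₂ (step E d)) g

embedPoint : Embedding → Point → Point
embedPoint E (s , q) = map (embedLetter E) s , embedPath E q

embedLetter-injective : ∀ E {g g′} → embedLetter E g ≡ embedLetter E g′ → g ≡ g′
embedLetter-injective E {[]}          {[]}            _  = refl
embedLetter-injective E {(d , b) ∷ g} {(d′ , b′) ∷ g′} eq
  with step-injective E d d′ (cong proj₁ (proj₁ (∷-injective eq))) | proj₂ (Prod.,-injective (proj₁ (∷-injective eq)))
... | refl | refl = cong ((d , b) ∷_) (embedLetter-injective _ (proj₂ (∷-injective eq)))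

embedLetter-node : ∀ E g {ρ} → Node (source E) (map proj₁ g) ρ → Legal (target E) (embedLetter E g)
embedLetter-node E [] _ = _ , here
embedLetter-node E (((i , l) , b) ∷ g) {ρ} (down ch n) with step-child E i l ch
... | ch′ , src with embedLetter-node (proj₂ (step E (i , l))) g
                       (subst (λ γ → Node γ (map proj₁ g) ρ) (sym src) n)
...   | σ , m = σ , down ch′ m

-- Only injectivity of `step` enters, so this covers letters and paths off the tree as well.
bit-embed : ∀ E b g q → bit b (embedLetter E g) (embedPath E q) ≡ bit b g q
bit-embed E b g               []       = refl
bit-embed E b []              (d ∷ q)  = refl
bit-embed E b ((d′ , b′) ∷ g) (d ∷ q) with d′ ≟ᵈ d
... | yes refl = trans (bit-self b (proj₁ (step E d)) b′ (embedLetter F g) (embedPath F q)) (bit-embed F b′ g q)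
  where
  F : Embedding
  F = proj₂ (step E d)
... | no d′≢d  = bit-other b b′ (embedLetter _ g) (embedPath _ q) (d′≢d ∘ step-injective E d′ d)

history-embed : ∀ E x k → history (embedLetter E ∘ x) k ≡ map (embedLetter E) (history x k)
history-embed E x zero    = refl
history-embed E x (suc k) = cong (embedLetter E (x k) ∷_) (history-embed E x k)

member-embed : ∀ E x p → member (embedLetter E ∘ x) (embedPoint E p) ≡ member x p
member-embed E x (s , q)
  rewrite length-map (embedLetter E) s
        | history-embed E x (length s)
        | bit-embed E false (x (length s)) q
  with s ≟ʰ history x (length s)
... | yes eq = cong (_∧ bit false (x (length s)) q) (dec-true (_ ≟ʰ _) (cong (map (embedLetter E)) eq))
... | no neq = cong (_∧ bit false (x (length s)) q)
                 (dec-false (_ ≟ʰ _) (neq ∘ map-injective (embedLetter-injective E)))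

S-mono : ∀ α β → α ≤ₒ β → S α ≼ S β
S-mono α β α≤β = (_≡ c) , ((λ _ → c) , λ { _ refl → 0 , λ _ → refl }) , factor
  where
  E : Embedding
  E = α , β , α≤β

  c : Map
  c = codeOf ∘ embedPoint E ∘ pointAt

  factor : S α ⊆ Gen (S β ∪ (_≡ c))
  factor f (x , legal , f≗χ) =
    gen-ext {f = χ (embedLetter E ∘ x) ∘ c}
      (λ n → sym (trans (f≗χ n) (cong (if_then 1 else 0)
        (sym (trans (cong (member (embedLetter E ∘ x)) (pointAt-codeOf (embedPoint E (pointAt n))))
                    (member-embed E x (pointAt n)))))))
      (gen-comp (gen-inc (inj₁ (_ , (λ k → embedLetter-node E (x k) (proj₂ (legal k))) , λ _ → refl)))
                (gen-inc (inj₂ refl)))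

-- Strictness

module _ (e : ℕ → Map) where

  eval : List ℕ → Map
  eval []      = id
  eval (n ∷ w) = e n ∘ eval w

  eval-++ : ∀ w w′ → eval (w ++ w′) ≗ eval w ∘ eval w′
  eval-++ []      w′ m = refl
  eval-++ (n ∷ w) w′ m = cong (e n) (eval-++ w w′ m)

  data NormalForm (α : Ord) (f : Map) : Set where
    word   : ∀ w → f ≗ eval w → NormalForm α f
    factor : ∀ u x w → LegalSeq α x → f ≗ u ∘ χ x ∘ eval w → NormalForm α f

  -- To the left of the rightmost factor from S α, everything may be forgotten.
  normalise : ∀ {α C f} → (∀ f → C f → ∃ λ n → e n ≗ f) → Gen (S α ∪ C) f → NormalForm α f
  normalise cov (gen-inc (inj₁ (x , legal , f≗χ))) = factor id x [] legal f≗χ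
  normalise cov (gen-inc (inj₂ c)) with cov _ c
  ... | n , eq = word (n ∷ []) λ m → sym (eq m)
  normalise cov (gen-ext f≗g p) with normalise cov p
  ... | word w eq             = word w λ m → trans (sym (f≗g m)) (eq m)
  ... | factor u x w legal eq = factor u x w legal λ m → trans (sym (f≗g m)) (eq m)
  normalise cov (gen-comp {f} {g} p q) with normalise cov q
  ... | factor u x w legal eq = factor (f ∘ u) x w legal λ m → cong f (eq m)
  ... | word w′ eq′ with normalise cov p
  ...   | word w eq = word (w ++ w′) λ m →
          trans (eq (g m)) (trans (cong (eval w) (eq′ m)) (sym (eval-++ w w′ m)))
  ...   | factor u x w legal eq = factor u x (w ++ w′) legal λ m →
          trans (eq (g m)) (cong (u ∘ χ x)
            (trans (cong (eval w) (eq′ m)) (sym (eval-++ w w′ m))))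

  select : Bool → Bool → Bool → Bool
  select a b z = if z then b else a

  -- Of a left factor `u` it matters only whether `u 0` and `u 1` equal 1, so arbitrary left factors
  -- reduce to two bits and countably many tasks remain. The first bit tells the two normal forms
  -- apart.
  Task : Set
  Task = Bool × List ℕ × Bool × Bool

  Task-enum : Enumeration Task
  Task-enum = ×-enum Bool-enum (×-enum (List-enum ℕ-enum) (×-enum Bool-enum Bool-enum))

  Bad : Ord → Task → (Point → Bool) → Set
  Bad α (false , w , _ , _) B = ∀ p → B p ≡ (eval w (codeOf p) ≡ᵇ 1)
  Bad α (true  , w , a , b) B = Σ (ℕ → Letter) λ y → LegalSeq α y ×
    (∀ p → B p ≡ select a b (member y (pointAt (eval w (codeOf p)))))

  avoid-bad : ∀ {α β} → α <ₒ β → ∀ t → Avoidable β (Bad α t)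
  avoid-bad {α} {β} α<β (false , w , _ , _) s with child-cofinal α β α<β
  ... | i , _ , eq , _ =
    -- A word alone determines the set, so contradicting it at one point is enough.
    (d , not z) ∷ [] , (_ , down eq here) , λ B bad match →
      not-¬ {z} refl (trans (sym (bad p)) (trans (match (d ∷ [])) (bit-self false d (not z) [] [])))
    where
    d : Direction
    d = i , 0
    p : Point
    p = s , d ∷ []
    z : Bool
    z = eval w (codeOf p) ≡ᵇ 1
  avoid-bad {α} α<β (true , w , a , b) s
    -- The map to defeat is the word `w` read over the history `s`; the letter obtained works
    -- against all legal `y` at once.
    with Defeat.defeat α (select a b) α<β (λ q → pointAt (eval w (codeOf (s , q))))
  ... | g , legal , h = g , legal , λ { B (y , legal-y , bad) match →
          h y legal-y λ r → trans (sym (bad (s , r))) (match r) }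

  NormalForm⇒Bad : ∀ {α x} → NormalForm α (χ x) → ∃ λ t → Bad α t (member x)
  NormalForm⇒Bad {α} {x} = λ
    { (word w eq) → (false , w , false , false) , λ p → trans (decoded p) (cong (_≡ᵇ 1) (eq (codeOf p)))
    ; (factor u y w legal eq) →
        (true , w , (u 0 ≡ᵇ 1) , (u 1 ≡ᵇ 1)) , y , legal , λ p →
          trans (decoded p) (trans (cong (_≡ᵇ 1) (eq (codeOf p))) (selected u _)) }
    where
    decoded : ∀ p → member x p ≡ (χ x (codeOf p) ≡ᵇ 1)
    decoded p = trans (cong (member x) (sym (pointAt-codeOf p)))
                      (sym (decode-encode Bool-enum (member x (pointAt (codeOf p)))))

    selected : ∀ u z → (u (if z then 1 else 0) ≡ᵇ 1) ≡ select (u 0 ≡ᵇ 1) (u 1 ≡ᵇ 1) z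
    selected u true  = refl
    selected u false = refl

-- A countable `C` leaves countably many tasks. A generic `x` legal for `β` avoids them all, whereas
-- generating `χ x` from `S α` and `C` would yield a task that `x` fails to avoid.
S-strict : ∀ α β → α <ₒ β → ¬ (S β ≼ S α)
S-strict α β α<β (C , (e , cov) , β⊆) = generic-avoids K avoid (encode E t)
    (subst (λ t → Bad e α t (member x)) (sym (decode-encode E t)) bad)
  where
  E : Enumeration (Task e)
  E = Task-enum e

  K : ℕ → (Point → Bool) → Set
  K n = Bad e α (decode E n)

  avoid : ∀ n → Avoidable β (K n)
  avoid n = avoid-bad e α<β (decode E n)

  x : ℕ → Letter
  x = generic K avoid

  defect : ∃ λ t → Bad e α t (member x)
  defect = NormalForm⇒Bad e (normalise e cov (β⊆ (χ x) (x , generic-legal K avoid , λ _ → refl)))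

  t : Task e
  t = proj₁ defect

  bad : Bad e α t (member x)
  bad = proj₂ defect

theorem6p1 : Σ (Ord → MapSet) λ S →
    (∀ α → IsSubsemigroupOfF₂ (S α)) ×
    (∀ α β → α <ₒ β → S α ≺ S β)
theorem6p1 = S , S-subsemigroup , λ α β α<β →
  S-mono α β (<ₒ⇒≤ₒ α β α<β) , λ { (_ , β≼α) → S-strict α β α<β β≼α }
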